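{- Let $A$ be the matrix defining the $3\times 4\times 6$ transportation problem, let $Q$ be the semigroup generated by its columns, let $f$ be the vector of right-hand sides and $z^*$ the point specified in the context, and let $A'$ be the matrix formed by the $24$ columns $A_{.,ijk}$ of $A$ for which $z^*_{ijk}>0$. Then the set of holes of $Q$ belonging to $f+Q$ is \[ \{f+A'\lambda' : \lambda'\in\mathbb{Z}_+^{24}\}. \] In particular, $f+Q$ contains infinitely many holes of $Q$.
   Context: Let $\mathbb{Z}_+$ denote the nonnegative integers. The $3\times4\times6$ transportation problem has variables $x_{ijk}$, $1\le i\le 3$, $1\le j\le 4$, $1\le k\le 6$, and constraints $\sum_i x_{ijk}=u_{jk}$, $\sum_j x_{ijk}=v_{ik}$, $\sum_k x_{ijk}=w_{ij}$. $A$ is the $0/1$ matrix with $72$ columns (and $12+18+24=54$ rows) sending $x=(x_{ijk})$ to the vector of all these sums $(w_{ij}),(v_{ik}),(u_{jk})$; $A_{.,ijk}$ is the column corresponding to the variable $x_{ijk}$. $Q=\{A\lambda:\lambda\in\mathbb{Z}_+^{72}\}$, $Q_{\mathrm{sat}}=\{A\lambda:\lambda\in\mathbb{R}^{72},\lambda\ge0\}\cap\{A\lambda:\lambda\in\mathbb{Z}^{72}\}$, and a hole of $Q$ is an element of $H=Q_{\mathrm{sat}}\setminus Q$. The vector $f$ (a hole found by Vlach) is given by three matrices: the $4\times 3$ matrix with rows indexed by $j$ and columns by $i$ of the $w_{ij}$, the $6\times3$ matrix with rows indexed by $k$ and columns by $i$ of the $v_{ik}$, and the $6\times 4$ matrix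 with rows indexed by $k$ and columns by $j$ of the $u_{jk}$, respectively \[ \begin{pmatrix}1&1&1\\1&1&1\\1&1&1\\1&1&1\end{pmatrix},\quad \begin{pmatrix}1&1&0\\1&1&0\\1&0&1\\1&0&1\\0&1&1\\0&1&1\end{pmatrix},\quad \begin{pmatrix}1&0&0&1\\0&1&1&0\\1&1&0&0\\0&0&1&1\\1&0&1&0\\0&1&0&1\end{pmatrix}. \] The point $z^*$ is the unique point of the polytope $\{z\in\mathbb{R}^{72}:Az=f,\ z\ge0\}$. Written as six $4\times3$ blocks for $k=1,\dots,6$ (rows indexed by $j$, columns by $i$), it is $\tfrac12$ times \[ \begin{pmatrix}1&1&0\\0&0&0\\0&0&0\\1&1&0\end{pmatrix}, \begin{pmatrix}0&0&0\\1&1&0\\1&1&0\\0&0&0\end{pmatrix}, \begin{pmatrix}1&0&1\\1&0&1\\0&0&0\\0&0&0\end{pmatrix}, \begin{pmatrix}0&0&0\\0&0&0\\1&0&1\\1&0&1\end{pmatrix}, \begin{pmatrix}0&1&1\\0&0&0\\0&1&1\\0&0&0\end{pmatrix}, \begin{pmatrix}0&0&0\\0&1&1\\0&0&0\\0&1&1\end{pmatrix}. \] -}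

module Defs where

open import Level using (0ℓ)
open import Algebra.Bundles.Raw using (RawMonoid)
import Algebra.Definitions.RawMonoid as RawMonoidDefs
open import Data.Bool.Base using (if_then_else_)
open import Data.Fin.Base using (Fin)
open import Data.Fin.Properties using (_≟_)
open import Data.Integer.Base as ℤ using (ℤ; +_)
open import Data.List.Base using (List; length; allFin; cartesianProduct; filter)
import Data.List.Base as List
open import Data.Nat.Base as ℕ using (ℕ; suc)
open import Data.Nat.Solver using (module +-*-Solver)
open import Data.Product.Base using (_×_; _,_; ∃-syntax)
open import Data.Rational.Base as ℚ using (ℚ; 0ℚ; ½)
import Data.Rational.Properties as ℚₚ
open import Data.Rational.Solver using () renaming (module +-*-Solver to ℚ-Solver)
open import Data.Rational.Unnormalised.Base using (mkℚᵘ; *≡*)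
import Data.Rational.Unnormalised.Properties as ℚᵘₚ
open import Data.Vec.Base using (Vec; []; _∷_; lookup)
open import Function.Definitions using (Injective)
open import Relation.Binary.PropositionalEquality
  using (_≡_; _≗_; refl; sym; cong; cong₂; subst)
open import Relation.Nullary.Decidable.Core using (Dec; does; _×-dec_)
open import Relation.Unary using (Pred; _∈_; _∩_; _∖_)

------------------------------------------------------------------------
-- Real numbers, following Bishop: x is given by rationals x₀, x₁, …
-- with |xₘ - xₙ| ≤ 1/(m+1) + 1/(n+1).

1/1+_ : ℕ → ℚ
1/1+ n = + 1 ℚ./ suc n

record ℝ : Set where
  constructor mkℝ
  field
    approx  : ℕ → ℚ
    regular : ∀ m n → ℚ.∣ approx m ℚ.- approx n ∣ ℚ.≤ 1/1+ m ℚ.+ 1/1+ n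

open ℝ public

infix 4 _≃_

_≃_ : ℝ → ℝ → Set
x ≃ y = ∀ n → ℚ.∣ approx x n ℚ.- approx y n ∣ ℚ.≤ 1/1+ n ℚ.+ 1/1+ n

NonNegative : ℝ → Set
NonNegative x = ∀ n → ℚ.- (1/1+ n) ℚ.≤ approx x n

1/1+-nonNeg : ∀ n → 0ℚ ℚ.≤ 1/1+ n
1/1+-nonNeg n = ℚₚ.nonNegative⁻¹ (1/1+ n) ⦃ ℚₚ.normalize-nonNeg 1 (suc n) ⦄

fromℚ : ℚ → ℝ
fromℚ q = mkℝ (λ _ → q) λ m n →
  subst (ℚ._≤ 1/1+ m ℚ.+ 1/1+ n) (sym (cong ℚ.∣_∣ (ℚₚ.+-inverseʳ q)))
    (ℚₚ.+-mono-≤ (1/1+-nonNeg m) (1/1+-nonNeg n))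

fromℤ : ℤ → ℝ
fromℤ z = fromℚ (z ℚ./ 1)

1/1+-halve : ∀ n → 1/1+ suc (n ℕ.+ n) ℚ.+ 1/1+ suc (n ℕ.+ n) ≡ 1/1+ n
1/1+-halve n = ℚₚ.toℚᵘ-injective
  (ℚᵘₚ.≃-trans (ℚₚ.toℚᵘ-homo-+ (1/1+ k) (1/1+ k))
  (ℚᵘₚ.≃-trans (ℚᵘₚ.+-cong (ℚₚ.toℚᵘ-fromℚᵘ (mkℚᵘ (+ 1) k)) (ℚₚ.toℚᵘ-fromℚᵘ (mkℚᵘ (+ 1) k)))
  (ℚᵘₚ.≃-trans (*≡* (cong +_ (solve 1 (λ m →
      (con 1 :* (con 2 :+ (m :+ m)) :+ con 1 :* (con 2 :+ (m :+ m))) :* (con 1 :+ m)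
        := con 1 :* ((con 2 :+ (m :+ m)) :* (con 2 :+ (m :+ m)))) refl n)))
  (ℚᵘₚ.≃-sym (ℚₚ.toℚᵘ-fromℚᵘ (mkℚᵘ (+ 1) n))))))
  where
  k = suc (n ℕ.+ n)
  open +-*-Solver

infixl 6 _+ℝ_

_+ℝ_ : ℝ → ℝ → ℝ
approx  (x +ℝ y) n = approx x (suc (n ℕ.+ n)) ℚ.+ approx y (suc (n ℕ.+ n))
regular (x +ℝ y) m n = begin
  ℚ.∣ (a ℚ.+ b) ℚ.- (c ℚ.+ d) ∣
    ≡⟨ cong ℚ.∣_∣ (solve 4 (λ a b c d → (a :+ b) :- (c :+ d) := (a :- c) :+ (b :- d)) refl a b c d) ⟩
  ℚ.∣ (a ℚ.- c) ℚ.+ (b ℚ.- d) ∣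
    ≤⟨ ℚₚ.∣p+q∣≤∣p∣+∣q∣ (a ℚ.- c) (b ℚ.- d) ⟩
  ℚ.∣ a ℚ.- c ∣ ℚ.+ ℚ.∣ b ℚ.- d ∣
    ≤⟨ ℚₚ.+-mono-≤ (regular x m′ n′) (regular y m′ n′) ⟩
  (1/1+ m′ ℚ.+ 1/1+ n′) ℚ.+ (1/1+ m′ ℚ.+ 1/1+ n′)
    ≡⟨ solve 2 (λ s t → (s :+ t) :+ (s :+ t) := (s :+ s) :+ (t :+ t)) refl (1/1+ m′) (1/1+ n′) ⟩
  (1/1+ m′ ℚ.+ 1/1+ m′) ℚ.+ (1/1+ n′ ℚ.+ 1/1+ n′)
    ≡⟨ cong₂ ℚ._+_ (1/1+-halve m) (1/1+-halve n) ⟩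
  1/1+ m ℚ.+ 1/1+ n ∎
  where
  open ℚₚ.≤-Reasoning
  open ℚ-Solver
  m′ = suc (m ℕ.+ m)
  n′ = suc (n ℕ.+ n)
  a = approx x m′
  b = approx y m′
  c = approx x n′
  d = approx y n′

ℝ-+-0-rawMonoid : RawMonoid 0ℓ 0ℓ
ℝ-+-0-rawMonoid = record { Carrier = ℝ ; _≈_ = _≃_ ; _∙_ = _+ℝ_ ; ε = fromℚ 0ℚ }

------------------------------------------------------------------------
-- The 3 × 4 × 6 transportation problem

Var : Set
Var = Fin 3 × Fin 4 × Fin 6

data Row : Set where
  w : (i : Fin 3) (j : Fin 4) → Row
  v : (i : Fin 3) (k : Fin 6) → Row
  u : (j : Fin 4) (k : Fin 6) → Row

vars : List Var
vars = cartesianProduct (allFin 3) (cartesianProduct (allFin 4) (allFin 6))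

indicator : ∀ {p} {P : Set p} → Dec P → ℕ
indicator P? = if does P? then 1 else 0

-- The variable (i , j , k) occurs, with coefficient 1, in exactly the three
-- sums w i j, v i k and u j k.

column : Var → Row → ℕ
column (i , j , k) (w i′ j′) = indicator ((i ≟ i′) ×-dec (j ≟ j′))
column (i , j , k) (v i′ k′) = indicator ((i ≟ i′) ×-dec (k ≟ k′))
column (i , j , k) (u j′ k′) = indicator ((j ≟ j′) ×-dec (k ≟ k′))

Matrix : ℕ → Set
Matrix n = Row → Fin n → ℕ

columns : (xs : List Var) → Matrix (length xs)
columns xs r c = column (List.lookup xs c) r

A : Matrix 72
A = columns vars

-- The product M x for a vector x over any additive monoid: since the entries
-- of M are natural numbers, only n-fold sums n · y are needed.

module Product {c ℓ} (R : RawMonoid c ℓ) where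
  open RawMonoid R using (Carrier)
  open RawMonoidDefs R using (sum) renaming (_×_ to _·_)

  infixl 7 _*ᵥ_

  _*ᵥ_ : ∀ {n} → Matrix n → (Fin n → Carrier) → Row → Carrier
  (M *ᵥ x) r = sum (λ c → M r c · x c)

open Product ℤ.+-0-rawMonoid public using () renaming (_*ᵥ_ to _*ℤ_)
open Product ℝ-+-0-rawMonoid public using () renaming (_*ᵥ_ to _*ℝ_)

infixl 7 _*ℕ_

_*ℕ_ : ∀ {n} → Matrix n → (Fin n → ℕ) → Row → ℤ
M *ℕ x = M *ℤ (λ c → + x c)

------------------------------------------------------------------------
-- The semigroup, its saturation and its holes, as sets of integer vectors

Q : Pred (Row → ℤ) 0ℓ
Q b = ∃[ x ] b ≗ A *ℕ x

Cone : Pred (Row → ℤ) 0ℓ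
Cone b = ∃[ x ] (∀ c → NonNegative (x c)) × (∀ r → fromℤ (b r) ≃ (A *ℝ x) r)

Lattice : Pred (Row → ℤ) 0ℓ
Lattice b = ∃[ x ] b ≗ A *ℤ x

Qsat : Pred (Row → ℤ) 0ℓ
Qsat = Cone ∩ Lattice

Holes : Pred (Row → ℤ) 0ℓ
Holes = Qsat ∖ Q

infixl 6 _+ᵥ_

_+ᵥ_ : (Row → ℤ) → (Row → ℤ) → Row → ℤ
(a +ᵥ b) r = a r ℤ.+ b r

translate : (Row → ℤ) → Pred (Row → ℤ) 0ℓ → Pred (Row → ℤ) 0ℓ
translate a P b = ∃[ q ] q ∈ P × b ≗ a +ᵥ q

-- Vectors are functions, so distinctness of elements is failure of _≗_.

Infinite : Pred (Row → ℤ) 0ℓ → Set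
Infinite P = ∃[ g ] (∀ (n : ℕ) → g n ∈ P) × Injective _≡_ _≗_ g

------------------------------------------------------------------------
-- The right-hand side f and the point z*

f : Row → ℤ
f (w i j) = lookup (lookup W j) i
  where
  W : Vec (Vec ℤ 3) 4
  W = (+ 1 ∷ + 1 ∷ + 1 ∷ [])
    ∷ (+ 1 ∷ + 1 ∷ + 1 ∷ [])
    ∷ (+ 1 ∷ + 1 ∷ + 1 ∷ [])
    ∷ (+ 1 ∷ + 1 ∷ + 1 ∷ []) ∷ []
f (v i k) = lookup (lookup V k) i
  where
  V : Vec (Vec ℤ 3) 6
  V = (+ 1 ∷ + 1 ∷ + 0 ∷ [])
    ∷ (+ 1 ∷ + 1 ∷ + 0 ∷ [])
    ∷ (+ 1 ∷ + 0 ∷ + 1 ∷ [])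
    ∷ (+ 1 ∷ + 0 ∷ + 1 ∷ [])
    ∷ (+ 0 ∷ + 1 ∷ + 1 ∷ [])
    ∷ (+ 0 ∷ + 1 ∷ + 1 ∷ []) ∷ []
f (u j k) = lookup (lookup U k) j
  where
  U : Vec (Vec ℤ 4) 6
  U = (+ 1 ∷ + 0 ∷ + 0 ∷ + 1 ∷ [])
    ∷ (+ 0 ∷ + 1 ∷ + 1 ∷ + 0 ∷ [])
    ∷ (+ 1 ∷ + 1 ∷ + 0 ∷ + 0 ∷ [])
    ∷ (+ 0 ∷ + 0 ∷ + 1 ∷ + 1 ∷ [])
    ∷ (+ 1 ∷ + 0 ∷ + 1 ∷ + 0 ∷ [])
    ∷ (+ 0 ∷ + 1 ∷ + 0 ∷ + 1 ∷ []) ∷ []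

z* : Var → ℚ
z* (i , j , k) = ½ ℚ.* (lookup (lookup (lookup Z k) j) i ℚ./ 1)
  where
  Z : Vec (Vec (Vec ℤ 3) 4) 6
  Z = ( (+ 1 ∷ + 1 ∷ + 0 ∷ [])
      ∷ (+ 0 ∷ + 0 ∷ + 0 ∷ [])
      ∷ (+ 0 ∷ + 0 ∷ + 0 ∷ [])
      ∷ (+ 1 ∷ + 1 ∷ + 0 ∷ []) ∷ [] )
    ∷ ( (+ 0 ∷ + 0 ∷ + 0 ∷ [])
      ∷ (+ 1 ∷ + 1 ∷ + 0 ∷ [])
      ∷ (+ 1 ∷ + 1 ∷ + 0 ∷ [])
      ∷ (+ 0 ∷ + 0 ∷ + 0 ∷ []) ∷ [] )
    ∷ ( (+ 1 ∷ + 0 ∷ + 1 ∷ [])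
      ∷ (+ 1 ∷ + 0 ∷ + 1 ∷ [])
      ∷ (+ 0 ∷ + 0 ∷ + 0 ∷ [])
      ∷ (+ 0 ∷ + 0 ∷ + 0 ∷ []) ∷ [] )
    ∷ ( (+ 0 ∷ + 0 ∷ + 0 ∷ [])
      ∷ (+ 0 ∷ + 0 ∷ + 0 ∷ [])
      ∷ (+ 1 ∷ + 0 ∷ + 1 ∷ [])
      ∷ (+ 1 ∷ + 0 ∷ + 1 ∷ []) ∷ [] )
    ∷ ( (+ 0 ∷ + 1 ∷ + 1 ∷ [])
      ∷ (+ 0 ∷ + 0 ∷ + 0 ∷ [])
      ∷ (+ 0 ∷ + 1 ∷ + 1 ∷ [])
      ∷ (+ 0 ∷ + 0 ∷ + 0 ∷ []) ∷ [] )
    ∷ ( (+ 0 ∷ + 0 ∷ + 0 ∷ [])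
      ∷ (+ 0 ∷ + 1 ∷ + 1 ∷ [])
      ∷ (+ 0 ∷ + 0 ∷ + 0 ∷ [])
      ∷ (+ 0 ∷ + 1 ∷ + 1 ∷ []) ∷ [] ) ∷ []

A′ : Matrix 24
A′ = columns (filter (λ x → 0ℚ ℚₚ.<? z* x) vars)

-- Write A_d for the column of A at a variable d.  If d lies off the support of
-- z*, then f + A_d ∈ Q; hence a hole f + A y involves only columns of A′.
-- Conversely f + A′ x is a hole:
--  * 2 f = A′ 1, so it lies in the cone, and f = (f + A_d) - A_d ∈ A ℤ^72;
--  * every A_d off the support is positive in some row where f and A′ vanish, so
--    f + A′ x = A y with y ≥ 0 forces f + A′ x = A′ y′, which is impossible
--    because some set of rows meets each column of A′ evenly but f oddly.
module Submission where

open import Defs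

open import Algebra.Bundles using (AbelianGroup; RawMonoid)
import Algebra.Definitions.RawMonoid as RawMonoidDefs
open import Data.Fin.Base using (Fin; zero; suc)
open import Data.Fin.Patterns using (0F; 1F; 2F; 3F; 4F; 5F)
import Data.Fin.Properties as Finₚ
open import Data.Integer.Base as ℤ using (ℤ; +_; 0ℤ; 1ℤ)
open import Data.Integer.Divisibility.Signed
  using (_∣_; _∣?_; divides; ∣m∣n⇒∣m+n; ∣m+n∣n⇒∣m; ∣m⇒∣m*n)
import Data.Integer.Properties as ℤₚ
open import Data.Integer.Solver using (module +-*-Solver)
open import Data.List.Base as List
  using (List; []; _∷_; length; allFin; cartesianProduct; filter)
open import Data.List.Membership.Propositional using () renaming (_∈_ to _∈ₗ_)
open import Data.List.Membership.Propositional.Properties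
  using (∈-cartesianProduct⁺; ∈-allFin; ∈-lookup; ∈-filter⁺)
open import Data.List.Relation.Unary.All as All using (All; all?)
open import Data.List.Relation.Unary.Any using (Any; any?; satisfied; index)
open import Data.List.Relation.Unary.Any.Properties using (lookup-index)
open import Data.Nat.Base as ℕ using (ℕ; zero; suc)
open import Data.Nat.DivMod using (_/_; _%_; _mod_)
import Data.Nat.Properties as ℕₚ
open import Data.Product.Base as Prod using (_×_; _,_; proj₂; ∃-syntax; uncurry)
open import Data.Rational.Base as ℚ using (ℚ; 0ℚ; ½)
import Data.Rational.Properties as ℚₚ
open import Data.Rational.Unnormalised.Base using (mkℚᵘ; *≡*)
import Data.Rational.Unnormalised.Properties as ℚᵘₚ
open import Data.Sum.Base as Sum using (_⊎_; inj₁; inj₂)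
open import Data.Vec.Base using (lookup; []; _∷_)
open import Function.Base using (_∘_)
open import Level using (Level; 0ℓ)
open import Relation.Binary.PropositionalEquality
open import Relation.Nullary.Decidable
  using (Dec; yes; no; map′; _×-dec_; _⊎-dec_; ¬?; from-no; toWitness; toWitnessFalse)
open import Relation.Nullary.Negation using (¬_; contradiction)
open import Relation.Unary using (Pred; Decidable; _∈_; _∉_; _∩_; _≐_)

open import Algebra.Properties.CommutativeMonoid.Mult ℤₚ.+-0-commutativeMonoid
  using (×-distrib-+) renaming (_×_ to _·_)
open import Algebra.Properties.CommutativeSemigroup ℤₚ.+-commutativeSemigroup using (interchange)
open import Algebra.Properties.Group (AbelianGroup.group ℤₚ.+-0-abelianGroup) using (∙-cancelˡ)
open import Algebra.Properties.Semiring.Mult ℤₚ.+-*-semiring using (×-assoc-*)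
open import Algebra.Properties.Semiring.Sum ℤₚ.+-*-semiring
  using (sum; sum-cong-≗; sum-replicate-zero; ∑-distrib-+; ∑-comm; *-distribʳ-sum)

-- Matrix products over additive monoids

module _ {a b c d : Level} {R : RawMonoid a b} {S : RawMonoid c d} where
  private
    module R = RawMonoid R
    module S = RawMonoid S
    module PR = Product R
    module PS = Product S

  -- The product is built from the unit and the operation alone, so a relation compatible with both
  -- passes from entries to products. Used with the graphs of negation, scaling, the embedding of
  -- the naturals, and halving into the reals.
  *ᵥ-preserves : (_~_ : R.Carrier → S.Carrier → Set) → R.ε ~ S.ε →
                 (∀ {x x′ y y′} → x ~ x′ → y ~ y′ → (x R.∙ y) ~ (x′ S.∙ y′)) →
                 ∀ {n} (M : Matrix n) {x y} → (∀ c → x c ~ y c) →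
                 ∀ ρ → (M PR.*ᵥ x) ρ ~ (M PS.*ᵥ y) ρ
  *ᵥ-preserves _~_ ε~ε ∙~∙ M x~y ρ = sum~ λ c → ·~ (M ρ c) (x~y c)
    where
    open RawMonoidDefs R using () renaming (_×_ to _·ᴿ_; sum to sumᴿ)
    open RawMonoidDefs S using () renaming (_×_ to _·ˢ_; sum to sumˢ)

    ·~ : ∀ n {x y} → x ~ y → (n ·ᴿ x) ~ (n ·ˢ y)
    ·~ zero    p = ε~ε
    ·~ (suc n) p = ∙~∙ p (·~ n p)

    sum~ : ∀ {n} {x : Fin n → R.Carrier} {y : Fin n → S.Carrier} →
           (∀ c → x c ~ y c) → sumᴿ x ~ sumˢ y
    sum~ {zero}  p = ε~ε
    sum~ {suc n} p = ∙~∙ (p zero) (sum~ (p ∘ suc))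

private variable
  n : ℕ

·-zeroʳ : ∀ m → m · 0ℤ ≡ 0ℤ
·-zeroʳ zero    = refl
·-zeroʳ (suc m) = trans (ℤₚ.+-identityˡ _) (·-zeroʳ m)

·-identityʳ : ∀ m → m · 1ℤ ≡ + m
·-identityʳ zero    = refl
·-identityʳ (suc m) = cong ℤ.suc (·-identityʳ m)

∑-zero : {x : Fin n → ℤ} → (∀ c → x c ≡ 0ℤ) → sum x ≡ 0ℤ
∑-zero {n} x≡0 = trans (sum-cong-≗ x≡0) (sum-replicate-zero n)

*ℤ-cong : (M : Matrix n) {x y : Fin n → ℤ} → x ≗ y → M *ℤ x ≗ M *ℤ y
*ℤ-cong M = *ᵥ-preserves _≡_ refl (cong₂ ℤ._+_) M

*ℤ-distrib-+ : (M : Matrix n) (x y : Fin n → ℤ) → M *ℤ (λ c → x c ℤ.+ y c) ≗ M *ℤ x +ᵥ M *ℤ y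
*ℤ-distrib-+ M x y r =
  trans (sum-cong-≗ (λ c → ×-distrib-+ (x c) (y c) (M r c)))
        (∑-distrib-+ (λ c → M r c · x c) (λ c → M r c · y c))

*ℤ-neg : (M : Matrix n) (x : Fin n → ℤ) → ∀ r → (M *ℤ (ℤ.-_ ∘ x)) r ≡ ℤ.- (M *ℤ x) r
*ℤ-neg M x = *ᵥ-preserves (λ i j → i ≡ ℤ.- j) refl
  (λ { {x′ = i} {y′ = j} refl refl → sym (ℤₚ.neg-distrib-+ i j) }) M λ c → refl

*ℕ-const : (M : Matrix n) (m : ℕ) → ∀ r → (M *ℕ (λ _ → m)) r ≡ + m ℤ.* (M *ℕ (λ _ → 1)) r
*ℕ-const M m = *ᵥ-preserves (λ i j → i ≡ + m ℤ.* j) (sym (ℤₚ.*-zeroʳ (+ m)))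
  (λ { {x′ = i} {y′ = j} refl refl → sym (ℤₚ.*-distribˡ-+ (+ m) i j) })
  M λ _ → sym (ℤₚ.*-identityʳ (+ m))

δ : Fin n → Fin n → ℕ
δ c e = indicator (c Finₚ.≟ e)

*ℕ-δ : (M : Matrix n) (c : Fin n) → ∀ r → (M *ℕ δ c) r ≡ + M r c
*ℕ-δ M zero    r = trans (cong₂ ℤ._+_ (·-identityʳ (M r zero)) (∑-zero (λ e → ·-zeroʳ (M r (suc e)))))
                         (ℤₚ.+-identityʳ _)
*ℕ-δ M (suc c) r = trans (cong₂ ℤ._+_ (·-zeroʳ (M r zero)) (*ℕ-δ (λ r e → M r (suc e)) c r))
                         (ℤₚ.+-identityˡ _)

δ≤ : (y : Fin n → ℕ) (c : Fin n) → y c ≢ 0 → ∀ e → δ c e ℕ.≤ y e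
δ≤ y c yc≢0 e with c Finₚ.≟ e
... | yes refl = ℕₚ.n≢0⇒n>0 yc≢0
... | no  _    = ℕ.z≤n

*ℕ-extract : (M : Matrix n) (y : Fin n → ℕ) (c : Fin n) → y c ≢ 0 →
             ∀ r → (M *ℕ y) r ≡ + M r c ℤ.+ (M *ℕ (λ e → y e ℕ.∸ δ c e)) r
*ℕ-extract M y c yc≢0 r = begin
  (M *ℕ y) r
    ≡⟨ *ℤ-cong M (λ e → cong +_ (ℕₚ.m+[n∸m]≡n (δ≤ y c yc≢0 e))) r ⟨
  (M *ℕ (λ e → δ c e ℕ.+ y′ e)) r
    ≡⟨ *ℤ-distrib-+ M (+_ ∘ δ c) (+_ ∘ y′) r ⟩
  (M *ℕ δ c) r ℤ.+ (M *ℕ y′) r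
    ≡⟨ cong (ℤ._+ (M *ℕ y′) r) (*ℕ-δ M c r) ⟩
  + M r c ℤ.+ (M *ℕ y′) r ∎
  where
  open ≡-Reasoning
  y′ = λ e → y e ℕ.∸ δ c e

-- The product is the image of a natural number, so nothing can cancel `m`.
+*ℕ≡0⇒≡0 : ∀ m (M : Matrix n) (y : Fin n → ℕ) r → + m ℤ.+ (M *ℕ y) r ≡ 0ℤ → m ≡ 0
+*ℕ≡0⇒≡0 m M y r m+My≡0 = ℕₚ.m+n≡0⇒m≡0 m {(M *ᴺ y) r} (ℤₚ.+-injective
  (trans (cong (ℤ._+_ (+ m)) (+My r)) m+My≡0))
  where
  open Product ℕ.+-0-rawMonoid renaming (_*ᵥ_ to _*ᴺ_)
  +My : ∀ r → + (M *ᴺ y) r ≡ (M *ℕ y) r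
  +My = *ᵥ-preserves (λ i j → + i ≡ j) refl (λ { refl refl → refl }) M λ c → refl

-- Selecting columns by a decidable predicate

module _ {p : Level} {P : Pred Var p} (P? : Decidable P) where

  -- Follows the recursion of `filter`, so that one match on `P? d` reduces both.
  filter-index : ∀ ds → Fin (length (filter P? ds)) → Fin (length ds)
  filter-index (d ∷ ds) c with P? d
  filter-index (d ∷ ds) c       | no  _ = suc (filter-index ds c)
  filter-index (d ∷ ds) zero    | yes _ = zero
  filter-index (d ∷ ds) (suc c) | yes _ = suc (filter-index ds c)

  columns-filter : ∀ ds (y : Fin (length ds) → ℤ) →
                   (∀ c → P (List.lookup ds c) ⊎ y c ≡ 0ℤ) →
                   columns (filter P? ds) *ℤ (y ∘ filter-index ds) ≗ columns ds *ℤ y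
  columns-filter []       y y∈P r = refl
  columns-filter (d ∷ ds) y y∈P r with P? d
  ... | yes _ = cong (ℤ._+_ (column d r · y zero)) (columns-filter ds (y ∘ suc) (y∈P ∘ suc) r)
  ... | no ¬Pd with y∈P zero
  ...   | inj₁ Pd   = contradiction Pd ¬Pd
  ...   | inj₂ y0≡0 = begin
    (columns (filter P? ds) *ℤ (y ∘ suc ∘ filter-index ds)) r
      ≡⟨ columns-filter ds (y ∘ suc) (y∈P ∘ suc) r ⟩
    (columns ds *ℤ (y ∘ suc)) r
      ≡⟨ ℤₚ.+-identityˡ _ ⟨
    0ℤ ℤ.+ (columns ds *ℤ (y ∘ suc)) r
      ≡⟨ cong (ℤ._+ _) (trans (cong (column d r ·_) y0≡0) (·-zeroʳ (column d r))) ⟨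
    column d r · y zero ℤ.+ (columns ds *ℤ (y ∘ suc)) r ∎
    where open ≡-Reasoning

  -- If some `y c` is nonzero at a variable outside `P`, one unit of that column is split off;
  -- otherwise restricting `y` to the filtered list loses nothing.
  columns-split : ∀ ds (y : Fin (length ds) → ℕ) →
                  (∃[ x ] columns ds *ℕ y ≗ columns (filter P? ds) *ℕ x)
                  ⊎ (∃[ d ] ∃[ y′ ] ¬ P d ×
                     columns ds *ℕ y ≗ (λ r → + column d r) +ᵥ columns ds *ℕ y′)
  columns-split ds y with Finₚ.all? (λ c → P? (List.lookup ds c) ⊎-dec y c ℕₚ.≟ 0)
  ... | yes y∈P = inj₁ (y ∘ filter-index ds , λ r →
          sym (columns-filter ds (+_ ∘ y) (Sum.map₂ (cong +_) ∘ y∈P) r))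
  ... | no  y∉P with Finₚ.¬∀⟶∃¬ _ _ (λ c → P? (List.lookup ds c) ⊎-dec y c ℕₚ.≟ 0) y∉P
  ...   | c , c∉P = inj₂ (List.lookup ds c , (λ e → y e ℕ.∸ δ c e) , c∉P ∘ inj₁ ,
                          *ℕ-extract (columns ds) y c (c∉P ∘ inj₂))

  -- A row where `b` vanishes cuts out a face of the cone. A column with entry 1 in that row cannot
  -- occur in `b`, since the other terms are nonnegative.
  columns-face : ∀ ds (y : Fin (length ds) → ℕ) (b : Row → ℤ) → b ≗ columns ds *ℕ y →
                 (∀ d → ¬ P d → ∃[ r ] b r ≡ 0ℤ × column d r ≡ 1) →
                 ∃[ x ] b ≗ columns (filter P? ds) *ℕ x
  columns-face ds y b b≗y face with columns-split ds y
  ... | inj₁ (x , y≗x) = x , λ r → trans (b≗y r) (y≗x r)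
  ... | inj₂ (d , y′ , d∉P , y≗d+y′) with face d d∉P
  ...   | r , br≡0 , dr≡1 = contradiction (trans (sym dr≡1)
          (+*ℕ≡0⇒≡0 (column d r) (columns ds) y′ r
            (trans (sym (y≗d+y′ r)) (trans (sym (b≗y r)) br≡0)))) λ ()

-- Closure properties of the semigroup, the lattice and the holes

Q-resp-≗ : ∀ {a b} → a ≗ b → a ∈ Q → b ∈ Q
Q-resp-≗ a≗b (x , eq) = x , λ r → trans (sym (a≗b r)) (eq r)

Q-+ : ∀ {a b} → a ∈ Q → b ∈ Q → a +ᵥ b ∈ Q
Q-+ (x , eqx) (y , eqy) = (λ c → x c ℕ.+ y c) , λ r →
  trans (cong₂ ℤ._+_ (eqx r) (eqy r)) (sym (*ℤ-distrib-+ A (+_ ∘ x) (+_ ∘ y) r))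

column-spanned : ∀ {d ds} → d ∈ₗ ds → ∃[ x ] (λ r → + column d r) ≗ columns ds *ℕ x
column-spanned {d} {ds} d∈ds = δ (index d∈ds) , λ r →
  trans (cong (λ e → + column e r) (lookup-index d∈ds)) (sym (*ℕ-δ (columns ds) (index d∈ds) r))

∈-vars : ∀ d → d ∈ₗ vars
∈-vars (i , j , k) = ∈-cartesianProduct⁺ (∈-allFin i) (∈-cartesianProduct⁺ (∈-allFin j) (∈-allFin k))

column-∈Q : ∀ d → (λ r → + column d r) ∈ Q
column-∈Q d = column-spanned (∈-vars d)

0∈Q : (λ _ → 0ℤ) ∈ Q
0∈Q = (λ _ → 0) , λ r → sym (∑-zero (λ c → ·-zeroʳ (A r c)))

-- Adds one column at a time, so `ds` may list a variable repeatedly, as a decoded list may.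
columns-∈Q : ∀ ds (x : Fin (length ds) → ℕ) → columns ds *ℕ x ∈ Q
columns-∈Q []       x = 0∈Q
columns-∈Q (d ∷ ds) x = Q-+ (multiple (x zero)) (columns-∈Q ds (x ∘ suc))
  where
  multiple : ∀ m → (λ r → column d r · + m) ∈ Q
  multiple zero    = Q-resp-≗ (λ r → sym (·-zeroʳ (column d r))) 0∈Q
  multiple (suc m) = Q-resp-≗
    (λ r → sym (trans (×-distrib-+ 1ℤ (+ m) (column d r))
                      (cong (ℤ._+ column d r · + m) (·-identityʳ (column d r)))))
    (Q-+ (column-∈Q d) (multiple m))

Q⊆Lattice : ∀ {b} → b ∈ Q → b ∈ Lattice
Q⊆Lattice (x , eq) = +_ ∘ x , eq

Lattice-minus : ∀ {a b} → a ∈ Lattice → b ∈ Lattice → (λ r → a r ℤ.- b r) ∈ Lattice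
Lattice-minus (x , eqx) (y , eqy) = (λ c → x c ℤ.- y c) , λ r →
  trans (cong₂ ℤ._-_ (eqx r) (eqy r))
  (sym (trans (*ℤ-distrib-+ A x (ℤ.-_ ∘ y) r) (cong (ℤ._+_ ((A *ℤ x) r)) (*ℤ-neg A y r))))

Lattice-resp-≗ : ∀ {a b} → a ≗ b → a ∈ Lattice → b ∈ Lattice
Lattice-resp-≗ a≗b (x , eq) = x , λ r → trans (sym (a≗b r)) (eq r)

Holes-resp-≗ : ∀ {a b} → a ≗ b → a ∈ Holes → b ∈ Holes
Holes-resp-≗ a≗b (((x , x≥0 , eq) , a∈L) , a∉Q) =
  ((x , x≥0 , λ r → subst (λ i → fromℤ i ≃ (A *ℝ x) r) (a≗b r) (eq r)) , Lattice-resp-≗ a≗b a∈L)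
  , a∉Q ∘ Q-resp-≗ (sym ∘ a≗b)

-- Half-integral points of the cone

half : ℤ → ℚ
half i = ½ ℚ.* (i ℚ./ 1)

/1-homo-+ : ∀ i j → (i ℚ./ 1) ℚ.+ (j ℚ./ 1) ≡ (i ℤ.+ j) ℚ./ 1
/1-homo-+ i j = ℚₚ.toℚᵘ-injective
  (ℚᵘₚ.≃-trans (ℚₚ.toℚᵘ-homo-+ (i ℚ./ 1) (j ℚ./ 1))
  (ℚᵘₚ.≃-trans (ℚᵘₚ.+-cong (ℚₚ.toℚᵘ-fromℚᵘ (mkℚᵘ i 0)) (ℚₚ.toℚᵘ-fromℚᵘ (mkℚᵘ j 0)))
  (ℚᵘₚ.≃-trans (*≡* (cong (ℤ._* 1ℤ) (cong₂ ℤ._+_ (ℤₚ.*-identityʳ i) (ℤₚ.*-identityʳ j))))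
  (ℚᵘₚ.≃-sym (ℚₚ.toℚᵘ-fromℚᵘ (mkℚᵘ (i ℤ.+ j) 0))))))

half-homo-+ : ∀ i j → half i ℚ.+ half j ≡ half (i ℤ.+ j)
half-homo-+ i j = trans (sym (ℚₚ.*-distribˡ-+ ½ (i ℚ./ 1) (j ℚ./ 1))) (cong (½ ℚ.*_) (/1-homo-+ i j))

half-double : ∀ i → half (i ℤ.+ i) ≡ i ℚ./ 1
half-double i = begin
  half (i ℤ.+ i)                ≡⟨ half-homo-+ i i ⟨
  half i ℚ.+ half i             ≡⟨ ℚₚ.*-distribʳ-+ (i ℚ./ 1) ½ ½ ⟨
  (½ ℚ.+ ½) ℚ.* (i ℚ./ 1)       ≡⟨ ℚₚ.*-identityˡ (i ℚ./ 1) ⟩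
  i ℚ./ 1 ∎
  where open ≡-Reasoning

half-nonNeg : ∀ m → 0ℚ ℚ.≤ half (+ m)
half-nonNeg m = ℚₚ.nonNegative⁻¹ (half (+ m))
  ⦃ ℚₚ.nonNeg*nonNeg⇒nonNeg ½ (+ m ℚ./ 1) ⦃ ℚₚ.normalize-nonNeg m 1 ⦄ ⦄

-- The relation ranges over all indices `k` because `_+ℝ_` reads its summands at a later index; as
-- the entries are constant sequences, every approximation is exact.
*ℝ-half : (M : Matrix n) (y : Fin n → ℤ) →
          ∀ r k → approx ((M *ℝ (fromℚ ∘ half ∘ y)) r) k ≡ half ((M *ℤ y) r)
*ℝ-half M y = *ᵥ-preserves (λ x i → ∀ k → approx x k ≡ half i) (λ _ → refl)
  (λ {_} {i} {_} {j} x≡i y≡j k →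
    trans (cong₂ ℚ._+_ (x≡i (suc (k ℕ.+ k))) (y≡j (suc (k ℕ.+ k)))) (half-homo-+ i j))
  M (λ _ _ → refl)

approx-const⇒≃ : ∀ q x → (∀ k → approx x k ≡ q) → fromℚ q ≃ x
approx-const⇒≃ q x x≡q k =
  subst (λ p → ℚ.∣ q ℚ.- p ∣ ℚ.≤ 1/1+ k ℚ.+ 1/1+ k)
    (sym (x≡q k)) (regular (fromℚ q) k k)

-- Stated for arbitrary M, since evaluating approx ((A *ℝ x) r) is exponential: every +ℝ doubles the index.
half-solution : (M : Matrix n) (y : Fin n → ℕ) (b : Row → ℤ) → b +ᵥ b ≗ M *ℕ y →
                ∃[ x ] (∀ c → NonNegative (x c)) × (∀ r → fromℤ (b r) ≃ (M *ℝ x) r)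
half-solution M y b 2b≗My = x
  , (λ c k → ℚₚ.≤-trans (ℚₚ.neg-antimono-≤ (1/1+-nonNeg k)) (half-nonNeg (y c)))
  , λ r → approx-const⇒≃ (b r ℚ./ 1) ((M *ℝ x) r) λ k →
      trans (*ℝ-half M (+_ ∘ y) r k) (trans (cong half (sym (2b≗My r))) (half-double (b r)))
  where
  x = fromℚ ∘ half ∘ +_ ∘ y

double∈Q⇒∈Cone : ∀ b → b +ᵥ b ∈ Q → b ∈ Cone
double∈Q⇒∈Cone b (y , 2b≗Ay) = half-solution A y b 2b≗Ay

-- Parity and vanishing rows

∑-even : {x : Fin n → ℤ} → (∀ c → + 2 ∣ x c) → + 2 ∣ sum x
∑-even {zero}  2∣x = divides 0ℤ refl
∑-even {suc n} 2∣x = ∣m∣n⇒∣m+n (2∣x zero) (∑-even (2∣x ∘ suc))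

·≡* : ∀ m i → m · i ≡ + m ℤ.* i
·≡* m i = begin
  m · i             ≡⟨ cong (m ·_) (ℤₚ.*-identityˡ i) ⟨
  m · (1ℤ ℤ.* i)    ≡⟨ ×-assoc-* m 1ℤ i ⟨
  (m · 1ℤ) ℤ.* i    ≡⟨ cong (ℤ._* i) (·-identityʳ m) ⟩
  + m ℤ.* i         ∎
  where open ≡-Reasoning

-- Exchanging the two sums gives an integer combination of the even column sums over `ρ`.
rows-even : ∀ {k} (M : Matrix n) (ρ : Fin k → Row) → (∀ c → + 2 ∣ sum (λ t → + M (ρ t) c)) →
            ∀ x → + 2 ∣ sum (λ t → (M *ℤ x) (ρ t))
rows-even M ρ 2∣M x = subst (+ 2 ∣_) (sym (∑-comm (λ t c → M (ρ t) c · x c))) (∑-even λ c →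
  subst (+ 2 ∣_) (trans (*-distribʳ-sum (x c) (λ t → + M (ρ t) c))
                        (sum-cong-≗ λ t → sym (·≡* (M (ρ t) c) (x c))))
    (∣m⇒∣m*n (x c) (2∣M c)))

-- Summed over the rows `ρ`, both products are even, which would force the sum of `b` to be even.
parity-obstruction : ∀ {k} (M : Matrix n) (ρ : Fin k → Row) → (∀ c → + 2 ∣ sum (λ t → + M (ρ t) c)) →
                     (b : Row → ℤ) → ¬ + 2 ∣ sum (b ∘ ρ) →
                     ∀ x y → ¬ b +ᵥ M *ℤ x ≗ M *ℤ y
parity-obstruction M ρ 2∣M b b-odd x y b+Mx≗My = b-odd (∣m+n∣n⇒∣m
  (subst (+ 2 ∣_) (trans (sym (sum-cong-≗ (b+Mx≗My ∘ ρ))) (∑-distrib-+ (b ∘ ρ) ((M *ℤ x) ∘ ρ)))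
    (rows-even M ρ 2∣M y))
  (rows-even M ρ 2∣M x))

-- The hypothesis says that the row sum is zero; the entries are natural numbers, so each of them is
-- zero.
*ℤ-zero-row : (M : Matrix n) → ∀ r → (M *ℕ (λ _ → 1)) r ≡ 0ℤ → ∀ x → (M *ℤ x) r ≡ 0ℤ
*ℤ-zero-row M r M1≡0 x = ∑-zero λ c → cong (_· x c) (+*ℕ≡0⇒≡0 (M r c) M _ r
  (trans (sym (*ℕ-extract M (λ _ → 1) c (λ ()) r)) M1≡0))

-- Finite checks on `f` and the support of `z*`

allRows? : ∀ {p} {P : Pred Row p} → Decidable P → Dec (∀ r → P r)
allRows? P? = map′
  (λ { (a , b , c) → λ { (w i j) → a i j ; (v i k) → b i k ; (u j k) → c j k } })
  (λ h → (λ i j → h (w i j)) , (λ i k → h (v i k)) , (λ j k → h (u j k)))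
  (Finₚ.all? (λ i → Finₚ.all? λ j → P? (w i j))
    ×-dec Finₚ.all? (λ i → Finₚ.all? λ k → P? (v i k))
    ×-dec Finₚ.all? (λ j → Finₚ.all? λ k → P? (u j k)))

Support : Pred Var 0ℓ
Support d = 0ℚ ℚ.< z* d

support? : Decidable Support
support? d = 0ℚ ℚₚ.<? z* d

A′1≗f+f : A′ *ℕ (λ _ → 1) ≗ f +ᵥ f
A′1≗f+f = toWitness {a? = allRows? λ r → (A′ *ℕ (λ _ → 1)) r ℤₚ.≟ (f +ᵥ f) r} _

cells : List (Fin 4 × Fin 6)
cells = filter (λ (j , k) → f (u j k) ℤₚ.≟ 1ℤ) (cartesianProduct (allFin 4) (allFin 6))

-- The list of cells fixes the number of digits, so leading zeros of a code count. The `mod 3` only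
-- serves to land in `Fin 3`.
decode : List (Fin 4 × Fin 6) → ℕ → List Var
decode []       n = []
decode (c ∷ cs) n = ((n % 10) mod 3 , c) ∷ decode cs (n / 10)

-- The digits of a code, least significant first, are the values of i at the
-- cells (j , k) of a decomposition of f + A_d into 13 columns of A.  The codes
-- were found by exhaustive search, one for each d off the support.
codes : List ℕ
codes
  = 2011201202001 ∷ 2012011201002 ∷ 2010211201002 ∷ 0212011201002
  ∷ 1202012001201 ∷ 2012011001202 ∷ 2010211001202 ∷ 0212011001202
  ∷ 1202002011201 ∷ 1201002012012 ∷ 1201002010212 ∷ 0212002011201
  ∷ 2001201202011 ∷ 1001202012012 ∷ 2000211202011 ∷ 1001200212012
  ∷ 1202012011210 ∷ 1202012101012 ∷ 2102011201012 ∷ 1202011201012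
  ∷ 2011201212010 ∷ 2011201012102 ∷ 2012101011202 ∷ 2011201011202
  ∷ 2011211202010 ∷ 2011211202100 ∷ 2101011202012 ∷ 1201011202012
  ∷ 1212012011200 ∷ 1212012101200 ∷ 1012102011202 ∷ 1011202011202
  ∷ 1021202012201 ∷ 2011201022201 ∷ 1201202012210 ∷ 2011202012201
  ∷ 1021202212010 ∷ 1201022202011 ∷ 1201202212010 ∷ 1202012202011
  ∷ 1022202011201 ∷ 2012201021201 ∷ 2012211201200 ∷ 2012202011201
  ∷ 2202011201021 ∷ 2212011021200 ∷ 2212011201200 ∷ 2202011202011 ∷ []

offSupport : List Var
offSupport = filter (¬? ∘ support?) vars

-- The `u` part of `f + A_d` is one unit on each of the twelve `cells` and one more at the cell of
-- `d`, whence 13 columns; the least significant digit belongs to the extra cell.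
Completes : Var → ℕ → Set
Completes d n = ∀ r → f r ℤ.+ + column d r ≡ (columns (decode (proj₂ d ∷ cells) n) *ℕ (λ _ → 1)) r

completes? : ∀ d n → Dec (Completes d n)
completes? d n = allRows? λ r →
  (f r ℤ.+ + column d r) ℤₚ.≟ (columns (decode (proj₂ d ∷ cells) n) *ℕ (λ _ → 1)) r

completions : All (λ d → Any (Completes d) codes) offSupport
completions = toWitness {a? = all? (λ d → any? (completes? d) codes) offSupport} _

SeparatedBy : Var → Row → Set
SeparatedBy d r = f r ≡ 0ℤ × column d r ≡ 1

-- Every `w` entry of `f` is 1, so only the other two rows through `d` can separate.
separatingRows : All (λ d@(i , j , k) → Any (SeparatedBy d) (v i k ∷ u j k ∷ [])) offSupport
separatingRows = toWitness {a? = all? (λ d@(i , j , k) →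
  any? (λ r → f r ℤₚ.≟ 0ℤ ×-dec column d r ℕₚ.≟ 1) (v i k ∷ u j k ∷ [])) offSupport} _

∈-offSupport : ∀ {d} → ¬ Support d → d ∈ₗ offSupport
∈-offSupport {d} d∉S = ∈-filter⁺ (¬? ∘ support?) (∈-vars d) d∉S

-- A solution of the linear system mod 2 requiring that every column of A′ meets
-- these rows evenly and f meets them oddly.
parityRows : Fin 9 → Row
parityRows = lookup
  ( w 1F 1F ∷ w 1F 2F ∷ w 2F 2F ∷ w 2F 3F ∷ v 1F 1F ∷ v 2F 3F ∷ v 2F 5F ∷ u 1F 5F ∷ u 2F 4F ∷ [] )

parity : (Row → ℤ) → ℤ
parity b = sum (b ∘ parityRows)

A′-even : ∀ c → + 2 ∣ parity (λ r → + A′ r c)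
A′-even c = All.lookup
  (toWitness {a? = all? (λ d → + 2 ∣? parity (λ r → + column d r)) (filter support? vars)} _)
  (∈-lookup {xs = filter support? vars} c)

-- `f` is 1 in each of the nine rows.
f-odd : ¬ + 2 ∣ parity f
f-odd = toWitnessFalse {a? = + 2 ∣? parity f} _

-- The vectors `f + A′ x` are holes

f+A′x≢A′y : ∀ x y → ¬ f +ᵥ A′ *ℤ x ≗ A′ *ℤ y
f+A′x≢A′y = parity-obstruction A′ parityRows A′-even f f-odd

-- The row sums of `A′` are the entries of `2 f`, so a zero of `f` forces a zero row of `A′`.
f≡0⇒A′x≡0 : ∀ r → f r ≡ 0ℤ → ∀ x → (A′ *ℤ x) r ≡ 0ℤ
f≡0⇒A′x≡0 r fr≡0 = *ℤ-zero-row A′ r (trans (A′1≗f+f r) (cong₂ ℤ._+_ fr≡0 fr≡0))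

f+A′x-face : ∀ x d → ¬ Support d → ∃[ r ] (f +ᵥ A′ *ℕ x) r ≡ 0ℤ × column d r ≡ 1
f+A′x-face x d d∉S = Prod.map₂
  (λ {r} (fr≡0 , dr≡1) → cong₂ ℤ._+_ fr≡0 (f≡0⇒A′x≡0 r fr≡0 (+_ ∘ x)) , dr≡1)
  (satisfied (All.lookup separatingRows (∈-offSupport d∉S)))

f+A′x∉Q : ∀ x → f +ᵥ A′ *ℕ x ∉ Q
f+A′x∉Q x (y , f+A′x≗Ay) = uncurry (λ x′ → f+A′x≢A′y (+_ ∘ x) (+_ ∘ x′))
  (columns-face support? vars y (f +ᵥ A′ *ℕ x) f+A′x≗Ay (f+A′x-face x))

A′x∈Q : ∀ x → A′ *ℕ x ∈ Q
A′x∈Q = columns-∈Q (filter support? vars)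

f+column∈Q : ∀ d → ¬ Support d → (λ r → f r ℤ.+ + column d r) ∈ Q
f+column∈Q d d∉S = uncurry
  (λ n eq → Q-resp-≗ (sym ∘ eq) (columns-∈Q (decode (proj₂ d ∷ cells) n) (λ _ → 1)))
  (satisfied (All.lookup completions (∈-offSupport d∉S)))

-- f + A′ x = (f + A_d) + A′ x - A_d for any d off the support.
f+A′x∈Lattice : ∀ x → f +ᵥ A′ *ℕ x ∈ Lattice
f+A′x∈Lattice x = Lattice-resp-≗ (λ r → lemma (f r) (+ column d r) ((A′ *ℕ x) r))
  (Lattice-minus (Q⊆Lattice (Q-+ (f+column∈Q d (from-no (support? d))) (A′x∈Q x)))
                 (Q⊆Lattice (column-∈Q d)))
  where
  lemma : ∀ i j k → i ℤ.+ j ℤ.+ k ℤ.- j ≡ i ℤ.+ k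
  lemma = solve 3 (λ i j k → i :+ j :+ k :- j := i :+ k) refl where open +-*-Solver
  d : Var
  d = 0F , 0F , 1F

-- 2 (f + A′ x) = A′ (1 + 2 x).
f+A′x∈Cone : ∀ x → f +ᵥ A′ *ℕ x ∈ Cone
f+A′x∈Cone x = double∈Q⇒∈Cone (f +ᵥ A′ *ℕ x) (Q-resp-≗
  {a = λ r → (A′ *ℕ (λ _ → 1)) r ℤ.+ ((A′ *ℕ x) r ℤ.+ (A′ *ℕ x) r)}
  (λ r → trans (cong (ℤ._+ ((A′ *ℕ x) r ℤ.+ (A′ *ℕ x) r)) (A′1≗f+f r))
               (interchange (f r) (f r) ((A′ *ℕ x) r) ((A′ *ℕ x) r)))
  (Q-+ (A′x∈Q (λ _ → 1)) (Q-+ (A′x∈Q x) (A′x∈Q x))))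

f+A′x∈Holes : ∀ x → f +ᵥ A′ *ℕ x ∈ Holes
f+A′x∈Holes x = (f+A′x∈Cone x , f+A′x∈Lattice x) , f+A′x∉Q x

-- The holes in `f + Q` and their infinitude

f+Q∖Q⊆f+A′x : ∀ {b} → b ∉ Q → b ∈ translate f Q → ∃[ x ] b ≗ f +ᵥ A′ *ℕ x
f+Q∖Q⊆f+A′x b∉Q (q , (y , q≗Ay) , b≗f+q) = Sum.[_,_]′
  (λ (x , Ay≗A′x) → x , λ r → trans (b≗f+q r) (cong (ℤ._+_ (f r)) (trans (q≗Ay r) (Ay≗A′x r))))
  (λ (d , y′ , d∉S , Ay≗d+Ay′) → contradiction
      (Q-resp-≗ (λ r → sym (trans (b≗f+q r) (trans (cong (ℤ._+_ (f r)) (trans (q≗Ay r) (Ay≗d+Ay′ r)))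
                              (sym (ℤₚ.+-assoc (f r) (+ column d r) ((A *ℕ y′) r))))))
        (Q-+ (f+column∈Q d d∉S) (y′ , λ r → refl)))
      b∉Q)
  (columns-split support? vars y)

f+A′x∈f+Q : ∀ x → f +ᵥ A′ *ℕ x ∈ translate f Q
f+A′x∈f+Q x = A′ *ℕ x , A′x∈Q x , λ r → refl

A′-const-injective : ∀ {m n} → A′ *ℕ (λ _ → m) ≗ A′ *ℕ (λ _ → n) → m ≡ n
A′-const-injective {m} {n} A′m≗A′n = ℤₚ.+-injective (ℤₚ.*-cancelʳ-≡ (+ m) (+ n) (+ 2)
  (trans (sym (entry m)) (trans (A′m≗A′n r) (entry n))))
  where
  -- `f` is 1 here, so this row of `A′` sums to 2 and the entry `2 n` determines `n`.
  r = w 0F 0F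
  entry : ∀ n → (A′ *ℕ (λ _ → n)) r ≡ + n ℤ.* + 2
  entry n = trans (*ℕ-const A′ n r) (cong (ℤ._*_ (+ n)) (A′1≗f+f r))

mainTheorem4 : ((Holes ∩ translate f Q) ≐ (λ b → ∃[ x ] b ≗ f +ᵥ A′ *ℕ x))
    × Infinite (Holes ∩ translate f Q)
mainTheorem4 =
  ( (λ { ((_ , b∉Q) , b∈f+Q) → f+Q∖Q⊆f+A′x b∉Q b∈f+Q })
  , (λ { (x , b≗f+A′x) → Holes-resp-≗ (sym ∘ b≗f+A′x) (f+A′x∈Holes x)
                       , A′ *ℕ x , A′x∈Q x , b≗f+A′x }))
  -- Since `A′ 1 = 2 f`, these are the odd multiples `(2 n + 1) f`.
  , (λ n → f +ᵥ A′ *ℕ (λ _ → n))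
  , (λ n → f+A′x∈Holes (λ _ → n) , f+A′x∈f+Q (λ _ → n))
  , λ eq → A′-const-injective λ r → ∙-cancelˡ (f r) _ _ (eq r)
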